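{- For every world $W$ of $\mathrm{LO}^{\mathrm{end}}$ there is an end-extension embedding $W\to W'$ such that $\mathsf{S5}\subseteq\mathrm{Val}_{\mathrm{LO}^{\mathrm{end}}}(W',\mathcal L^{\Diamond}_{\le}(W'))$, i.e. $W'$ validates $\mathsf{S5}$ with parameters.
   Context: Linear orders are total orders, possibly empty. $\mathrm{LO}^{\mathrm{end}}$ is the category of linear orders whose morphisms are end-extension embeddings, i.e. order-embeddings whose image is an initial segment of the target. $\mathcal L^{\Diamond}_{\le}(W')$ is the modal extension (operators $\Diamond,\Box$) of $\{\le\}$ with constants naming elements of $W'$ (transported along morphisms). Modal satisfaction: $U\models\Diamond\varphi[\nu]$ iff there is a morphism $f:U\to V$ with $V\models\varphi[f\circ\nu]$; $\Box$ dually. $\mathrm{Val}(W,\Gamma)$ is the set of propositional modal formulas $\psi(p_0,\dots,p_n)$ all of whose substitution instances $\psi(\varphi_0,\dots,\varphi_n)$ with $\varphi_i\in\Gamma$ hold at $W$. $\mathsf{S5}$ is the normal modal logic axiomatized by $\Box p\to p$, $\Box p\to\Box\Box p$ and $\Diamond\Box p\to p$. -}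

module Defs where

open import Level using (Level; Lift) renaming (suc to lsuc)
open import Data.Nat using (ℕ; zero; suc)
open import Data.Fin using (Fin) renaming (zero to fz; suc to fs)
open import Data.Bool using (Bool; true; false; not; _∨_)
open import Data.Empty using (⊥)
open import Data.Unit using (⊤)
open import Data.Product using (Σ; _×_)
open import Function using (_∘_; id)
open import Relation.Binary using (Rel; IsTotalOrder)
open import Relation.Binary.PropositionalEquality using (_≡_)

record LO (ℓ : Level) : Set (lsuc ℓ) where
  field
    Carrier      : Set ℓ
    _≤_          : Rel Carrier ℓ
    isTotalOrder : IsTotalOrder _≡_ _≤_

open LO public

record EndExt {ℓ : Level} (U V : LO ℓ) : Set ℓ where
  field
    fun     : Carrier U → Carrier V
    embed   : ∀ x y → _≤_ U x y → _≤_ V (fun x) (fun y)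
    reflect : ∀ x y → _≤_ V (fun x) (fun y) → _≤_ U x y
    initial : ∀ x y → _≤_ V y (fun x) → Σ (Carrier U) (λ z → fun z ≡ y)

open EndExt public

infixr 5 _⇒ᵐ_
data MForm : Set where
  var  : ℕ → MForm
  ⊥ᵐ   : MForm
  _⇒ᵐ_ : MForm → MForm → MForm
  □ᵐ   : MForm → MForm

¬ᵐ : MForm → MForm
¬ᵐ φ = φ ⇒ᵐ ⊥ᵐ

◇ᵐ : MForm → MForm
◇ᵐ φ = ¬ᵐ (□ᵐ (¬ᵐ φ))

evalB : (ℕ → Bool) → (MForm → Bool) → MForm → Bool
evalB v b (var i)  = v i
evalB v b ⊥ᵐ       = false
evalB v b (φ ⇒ᵐ ψ) = not (evalB v b φ) ∨ evalB v b ψ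
evalB v b (□ᵐ φ)   = b φ

Tautology : MForm → Set
Tautology φ = ∀ (v : ℕ → Bool) (b : MForm → Bool) → evalB v b φ ≡ true

-- S5: smallest normal modal logic containing T, 4 and ◇□p → p
-- (axioms given as schemata, so closure under substitution is built in).
data S5 : MForm → Set where
  taut : ∀ {φ} → Tautology φ → S5 φ
  axK  : ∀ {φ ψ} → S5 (□ᵐ (φ ⇒ᵐ ψ) ⇒ᵐ □ᵐ φ ⇒ᵐ □ᵐ ψ)
  axT  : ∀ {φ} → S5 (□ᵐ φ ⇒ᵐ φ)
  ax4  : ∀ {φ} → S5 (□ᵐ φ ⇒ᵐ □ᵐ (□ᵐ φ))
  axB  : ∀ {φ} → S5 (◇ᵐ (□ᵐ φ) ⇒ᵐ φ)
  mp   : ∀ {φ ψ} → S5 (φ ⇒ᵐ ψ) → S5 φ → S5 ψ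
  nec  : ∀ {φ} → S5 φ → S5 (□ᵐ φ)

module _ {ℓ : Level} (W : LO ℓ) where

  data Term (n : ℕ) : Set ℓ where
    v   : Fin n → Term n
    con : Carrier W → Term n

  infixr 5 _⇒ᶠ_
  data Form : ℕ → Set ℓ where
    _≤ᶠ_ : ∀ {n} → Term n → Term n → Form n
    _≐ᶠ_ : ∀ {n} → Term n → Term n → Form n
    ⊥ᶠ   : ∀ {n} → Form n
    _⇒ᶠ_ : ∀ {n} → Form n → Form n → Form n
    ∀ᶠ   : ∀ {n} → Form (suc n) → Form n
    □ᶠ   : ∀ {n} → Form n → Form n

  Sentence : Set ℓ
  Sentence = Form 0

extend : ∀ {a} {A : Set a} {n} → A → (Fin n → A) → Fin (suc n) → A
extend a ν fz     = a
extend a ν (fs i) = ν i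

-- Satisfaction at world U, where κ interprets the constants (the
-- transport of W's elements along morphisms) and ν assigns variables.
module _ {ℓ : Level} {W : LO ℓ} where

  evalT : ∀ {n} (U : LO ℓ) → Term W n → (Carrier W → Carrier U)
        → (Fin n → Carrier U) → Carrier U
  evalT U (v i)   κ ν = ν i
  evalT U (con c) κ ν = κ c

  Sat : ∀ {n} (U : LO ℓ) → (Carrier W → Carrier U) → (Fin n → Carrier U)
        → Form W n → Set (lsuc ℓ)
  Sat U κ ν (t ≤ᶠ s) = Lift (lsuc ℓ) (_≤_ U (evalT U t κ ν) (evalT U s κ ν))
  Sat U κ ν (t ≐ᶠ s) = Lift (lsuc ℓ) (evalT U t κ ν ≡ evalT U s κ ν)
  Sat U κ ν ⊥ᶠ       = Lift (lsuc ℓ) ⊥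
  Sat U κ ν (φ ⇒ᶠ ψ) = Sat U κ ν φ → Sat U κ ν ψ
  Sat U κ ν (∀ᶠ φ)   = (a : Carrier U) → Sat U κ (extend a ν) φ
  Sat U κ ν (□ᶠ φ)   = (V : LO ℓ) (f : EndExt U V) → Sat V (fun f ∘ κ) (fun f ∘ ν) φ

  HoldsAt : Sentence W → Set (lsuc ℓ)
  HoldsAt φ = Sat W id (λ ()) φ

  subst : (ℕ → Sentence W) → MForm → Sentence W
  subst σ (var i)  = σ i
  subst σ ⊥ᵐ       = ⊥ᶠ
  subst σ (φ ⇒ᵐ ψ) = subst σ φ ⇒ᶠ subst σ ψ
  subst σ (□ᵐ φ)   = □ᶠ (subst σ φ)

Val : ∀ {ℓ} (W : LO ℓ) → (Sentence W → Set ℓ) → MForm → Set (lsuc ℓ)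
Val W Γ ψ = (σ : ℕ → Sentence W) → (∀ i → Γ (σ i)) → HoldsAt {W = W} (subst σ ψ)

AllSentences : ∀ {ℓ} (W : LO ℓ) → Sentence W → Set ℓ
AllSentences W _ = Lift _ ⊤

{-# OPTIONS --safe #-}

-- Modal satisfaction is controlled by Ehrenfeucht–Fraïssé games whose moves either pick a
-- point or pass to an end-extension.  For each n there are finitely many n-round types of
-- linear orders, so countably many orders represent all types.  Let S be a shuffle of these
-- representatives: a sum over a dense order in which every representative occurs between any
-- two blocks.  Then D ⊕ M ⊕ S is n-equivalent to D for every final part D of S and every M,
-- since both are again shuffles up to n-equivalence and the game cannot tell shuffles apart.
-- Hence W′ = W ⊕ S works: an extension of W′ has the form W′ ⊕ M, and W′ ⊕ M ⊕ S satisfies the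
-- same formulas as W′ about any given finite set of parameters from W′, so whatever is
-- possibly necessary at W′ is already necessary at W′.

module Submission where

open import Defs
open import Level using (Level; Lift; lift; lower) renaming (suc to lsuc)
open import Axiom.ExcludedMiddle using (ExcludedMiddle)
open import Data.Bool using (true; if_then_else_)
open import Data.Empty using (⊥-elim)
open import Data.Empty.Polymorphic using (⊥)
open import Data.Fin using (Fin; toℕ; combine; finToFun; funToFin) renaming (zero to fz; suc to fs)
open import Data.Fin.Properties using (combine-injective; finToFun-funToFin; toℕ-injective)
open import Data.Irrelevant using ([_])
open import Data.List using (List; []; _∷_; _++_)
open import Data.List.Relation.Unary.All as All using (All; []; _∷_)
open import Data.List.Relation.Unary.All.Properties using (++⁻)
open import Data.Nat using (ℕ; zero; suc; _+_; _*_; _^_; _⊔_; z≤n; s≤s) renaming (_≤_ to _≤ⁿ_)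
open import Data.Nat.Properties using (+-suc; +-identityʳ; suc-injective; m⊔n≤o⇒m≤o; m⊔n≤o⇒n≤o; ≤-refl)
open import Data.Product using (Σ; ∃; _×_; _,_)
open import Data.Refinement using (Refinement-syntax; value; _,_)
open import Data.Sum using (_⊎_; inj₁; inj₂; [_,_]′) renaming (map to map-⊎)
open import Data.Sum.Relation.Binary.LeftOrder using (_⊎-<_; ₁∼₁; ₁∼₂; ₂∼₂; ⊎-<-refl; ⊎-<-transitive; ⊎-<-antisymmetric; ⊎-<-total)
open import Data.Sum.Relation.Binary.Pointwise using (Pointwise; inj₁; inj₂; Pointwise-≡⇒≡)
open import Function using (_∘_; id; flip)
open import Relation.Binary using (Rel; REL; _⇒_; IsTotalOrder; Reflexive; Transitive; Antisymmetric; Total)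
open import Relation.Binary.PropositionalEquality using (_≡_; refl; sym; trans; cong; subst₂; isEquivalence) renaming (subst to transport)
open import Relation.Nullary using (¬_; Dec; yes; no; does; proof; contradiction)
open import Relation.Nullary.Decidable using (map′; decidable-stable)
open import Relation.Nullary.Recomputable using (¬-recompute)
open import Relation.Nullary.Reflects using (Reflects; ofʸ; ofⁿ; _→-reflects_)

private variable
  a ℓ : Level
  m n k : ℕ
  U V U′ V′ A A′ B B′ C : LO ℓ

-- Linear orders

module Ord {ℓ} (U : LO ℓ) = IsTotalOrder (isTotalOrder U)

linearOrder : {X : Set ℓ} (_≼_ : Rel X ℓ) → Reflexive _≼_ → Transitive _≼_ →
              Antisymmetric _≡_ _≼_ → Total _≼_ → LO ℓ
linearOrder {X = X} _ _ _ _ _ .Carrier = X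
linearOrder _≼_ _ _ _ _ ._≤_ = _≼_
linearOrder _ ≼-refl ≼-trans ≼-antisym ≼-total .isTotalOrder = record
  { isPartialOrder = record
    { isPreorder = record
      { isEquivalence = isEquivalence
      ; reflexive = λ { refl → ≼-refl }
      ; trans = ≼-trans
      }
    ; antisym = ≼-antisym
    }
  ; total = ≼-total
  }

𝟘 : LO ℓ
𝟘 = linearOrder {X = ⊥} (λ _ _ → ⊥) (λ {}) (λ {}) (λ {}) (λ ())

-- Abstract so that unification sees the summands in A ⊕ B instead of unfolding the proof.
abstract
  ⊕-isTotalOrder : (A B : LO ℓ) → IsTotalOrder _≡_ (_≤_ A ⊎-< _≤_ B)
  ⊕-isTotalOrder A B = isTotalOrder (linearOrder (_≤_ A ⊎-< _≤_ B)
    (⊎-<-refl (Ord.refl A) (Ord.refl B))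
    (⊎-<-transitive (Ord.trans A) (Ord.trans B))
    (λ p q → Pointwise-≡⇒≡ (⊎-<-antisymmetric (Ord.antisym A) (Ord.antisym B) p q))
    (⊎-<-total (Ord.total A) (Ord.total B)))

infixl 6 _⊕_
_⊕_ : LO ℓ → LO ℓ → LO ℓ
A ⊕ B = record { isTotalOrder = ⊕-isTotalOrder A B }

idExt : EndExt U U
idExt = record
  { fun = id ; embed = λ _ _ → id ; reflect = λ _ _ → id ; initial = λ _ y _ → y , refl }

infixr 9 _∘ᴱ_
_∘ᴱ_ : EndExt V C → EndExt U V → EndExt U C
g ∘ᴱ f = record
  { fun = fun g ∘ fun f
  ; embed = λ x y → embed g _ _ ∘ embed f x y
  ; reflect = λ x y → reflect f x y ∘ reflect g _ _
  ; initial = init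
  }
  where
  init : ∀ x y → _ → Σ _ (λ z → fun g (fun f z) ≡ y)
  init x y y≤ with initial g _ y y≤
  ... | z , refl with initial f x z (reflect g _ _ y≤)
  ... | w , refl = w , refl

fun-injective : (f : EndExt U V) → ∀ {x y} → fun f x ≡ fun f y → x ≡ y
fun-injective {U = U} {V = V} f eq = Ord.antisym U
  (reflect f _ _ (Ord.reflexive V eq)) (reflect f _ _ (Ord.reflexive V (sym eq)))

inlExt : EndExt A (A ⊕ B)
inlExt = record
  { fun = inj₁
  ; embed = λ _ _ → ₁∼₁
  ; reflect = λ { _ _ (₁∼₁ p) → p }
  ; initial = λ { _ _ (₁∼₁ {x = z} _) → z , refl }
  }

⊕-extʳ : EndExt B B′ → EndExt (A ⊕ B) (A ⊕ B′)
⊕-extʳ f = record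
  { fun = map-⊎ id (fun f)
  ; embed = λ { _ _ (₁∼₁ p) → ₁∼₁ p ; _ _ ₁∼₂ → ₁∼₂ ; _ _ (₂∼₂ p) → ₂∼₂ (embed f _ _ p) }
  ; reflect = λ { (inj₁ _) (inj₁ _) (₁∼₁ p) → ₁∼₁ p
                ; (inj₁ _) (inj₂ _) _ → ₁∼₂
                ; (inj₂ _) (inj₂ _) (₂∼₂ p) → ₂∼₂ (reflect f _ _ p) }
  ; initial = init
  }
  where
  init : ∀ x y → _ → Σ _ (λ z → map-⊎ id (fun f) z ≡ y)
  init x (inj₁ y) _ = inj₁ y , refl
  init (inj₂ x) (inj₂ y) (₂∼₂ p) with initial f x y p
  ... | z , refl = inj₂ z , refl

-- Isomorphisms

infix 4 _≅_
record _≅_ (U V : LO ℓ) : Set ℓ where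
  field
    to      : Carrier U → Carrier V
    from    : Carrier V → Carrier U
    to-from : ∀ y → to (from y) ≡ y
    mono    : ∀ {x y} → _≤_ U x y → _≤_ V (to x) (to y)
    cancel  : ∀ {x y} → _≤_ V (to x) (to y) → _≤_ U x y

  ext : EndExt U V
  ext = record
    { fun = to ; embed = λ _ _ → mono ; reflect = λ _ _ → cancel
    ; initial = λ _ y _ → from y , to-from y }

  from-to : ∀ x → from (to x) ≡ x
  from-to x = fun-injective ext (to-from (to x))

open _≅_

≅-refl : U ≅ U
≅-refl = record { to = id ; from = id ; to-from = λ _ → refl ; mono = id ; cancel = id }

≅-sym : U ≅ V → V ≅ U
≅-sym {V = V} α = record
  { to = from α
  ; from = to α
  ; to-from = from-to α
  ; mono = λ p → cancel α (subst₂ (_≤_ V) (sym (to-from α _)) (sym (to-from α _)) p)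
  ; cancel = λ p → subst₂ (_≤_ V) (to-from α _) (to-from α _) (mono α p)
  }

≅-trans : U ≅ V → V ≅ C → U ≅ C
≅-trans α β = record
  { to = to β ∘ to α
  ; from = from α ∘ from β
  ; to-from = λ z → trans (cong (to β) (to-from α _)) (to-from β z)
  ; mono = mono β ∘ mono α
  ; cancel = cancel α ∘ cancel β
  }

⊕-cong : A ≅ A′ → B ≅ B′ → A ⊕ B ≅ A′ ⊕ B′
⊕-cong α β = record
  { to = map-⊎ (to α) (to β)
  ; from = map-⊎ (from α) (from β)
  ; to-from = λ { (inj₁ x) → cong inj₁ (to-from α x) ; (inj₂ x) → cong inj₂ (to-from β x) }
  ; mono = λ { (₁∼₁ p) → ₁∼₁ (mono α p) ; ₁∼₂ → ₁∼₂ ; (₂∼₂ p) → ₂∼₂ (mono β p) }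
  ; cancel = λ { {inj₁ _} {inj₁ _} (₁∼₁ p) → ₁∼₁ (cancel α p)
               ; {inj₁ _} {inj₂ _} _ → ₁∼₂
               ; {inj₂ _} {inj₂ _} (₂∼₂ p) → ₂∼₂ (cancel β p) }
  }

⊕-assoc : (A B C : LO ℓ) → A ⊕ B ⊕ C ≅ A ⊕ (B ⊕ C)
⊕-assoc A B C = record
  { to = λ { (inj₁ (inj₁ x)) → inj₁ x ; (inj₁ (inj₂ x)) → inj₂ (inj₁ x) ; (inj₂ x) → inj₂ (inj₂ x) }
  ; from = λ { (inj₁ x) → inj₁ (inj₁ x) ; (inj₂ (inj₁ x)) → inj₁ (inj₂ x) ; (inj₂ (inj₂ x)) → inj₂ x }
  ; to-from = λ { (inj₁ _) → refl ; (inj₂ (inj₁ _)) → refl ; (inj₂ (inj₂ _)) → refl }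
  ; mono = λ { (₁∼₁ (₁∼₁ p)) → ₁∼₁ p ; (₁∼₁ ₁∼₂) → ₁∼₂ ; (₁∼₁ (₂∼₂ p)) → ₂∼₂ (₁∼₁ p)
             ; {inj₁ (inj₁ _)} ₁∼₂ → ₁∼₂ ; {inj₁ (inj₂ _)} ₁∼₂ → ₂∼₂ ₁∼₂ ; (₂∼₂ p) → ₂∼₂ (₂∼₂ p) }
  ; cancel = λ { {inj₁ (inj₁ _)} {inj₁ (inj₁ _)} (₁∼₁ p) → ₁∼₁ (₁∼₁ p)
               ; {inj₁ (inj₁ _)} {inj₁ (inj₂ _)} _ → ₁∼₁ ₁∼₂
               ; {inj₁ (inj₁ _)} {inj₂ _} _ → ₁∼₂
               ; {inj₁ (inj₂ _)} {inj₁ (inj₂ _)} (₂∼₂ (₁∼₁ p)) → ₁∼₁ (₂∼₂ p)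
               ; {inj₁ (inj₂ _)} {inj₂ _} _ → ₁∼₂
               ; {inj₂ _} {inj₁ (inj₁ _)} ()
               ; {inj₂ _} {inj₁ (inj₂ _)} (₂∼₂ ())
               ; {inj₂ _} {inj₂ _} (₂∼₂ (₂∼₂ p)) → ₂∼₂ p }
  }

-- Complements of initial segments

-- The refinement is proof-irrelevant because negations are not provably
-- propositional without function extensionality.
complement : {U V : LO ℓ} → EndExt U V → LO ℓ
complement {V = V} f .Carrier = [ y ∈ Carrier V ∣ ¬ ∃ (λ x → fun f x ≡ y) ]
complement {V = V} f ._≤_ p q = _≤_ V (value p) (value q)
complement {V = V} f .isTotalOrder = isTotalOrder (linearOrder _
  (Ord.refl V) (Ord.trans V)
  (λ p q → value-injective (Ord.antisym V p q))
  (λ p q → Ord.total V (value p) (value q)))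
  where
  value-injective : {p q : [ y ∈ Carrier V ∣ ¬ ∃ (λ x → fun f x ≡ y) ]} → value p ≡ value q → p ≡ q
  value-injective refl = refl

module _ {U V : LO ℓ} (f : EndExt U V) where

  complement-∉ : (y : Carrier (complement f)) → ∀ x → ¬ fun f x ≡ value y
  complement-∉ (y , [ ∉ ]) x eq = ¬-recompute ∉ (x , eq)

  -- Excluded middle sorts the points of `V` by membership in the image. The image is an initial
  -- segment, so no point outside it lies below a point of it.
  complement-iso : ExcludedMiddle ℓ → U ⊕ complement f ≅ V
  complement-iso em = record
    { to = [ fun f , value ]′
    ; from = λ y → split y em
    ; to-from = λ y → split-≡ y em
    ; mono = λ { (₁∼₁ p) → embed f _ _ p
               ; {inj₁ x} {inj₂ y} ₁∼₂ → before x y (Ord.total V (fun f x) (value y))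
               ; (₂∼₂ p) → p }
    ; cancel = λ { {inj₁ _} {inj₁ _} p → ₁∼₁ (reflect f _ _ p)
                 ; {inj₁ _} {inj₂ _} _ → ₁∼₂
                 ; {inj₂ y} {inj₁ x} p → ⊥-elim (not-below x y p)
                 ; {inj₂ _} {inj₂ _} p → ₂∼₂ p }
    }
    where
    split : ∀ y → Dec (∃ λ x → fun f x ≡ y) → Carrier (U ⊕ complement f)
    split y (yes (x , _)) = inj₁ x
    split y (no ∉) = inj₂ (y , [ ∉ ])
    split-≡ : ∀ y d → [ fun f , value ]′ (split y d) ≡ y
    split-≡ y (yes (_ , eq)) = eq
    split-≡ y (no _) = refl
    not-below : ∀ x (y : Carrier (complement f)) → ¬ _≤_ V (value y) (fun f x)
    not-below x y p = let z , eq = initial f x (value y) p in complement-∉ y z eq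
    before : ∀ x (y : Carrier (complement f)) →
             _≤_ V (fun f x) (value y) ⊎ _≤_ V (value y) (fun f x) → _≤_ V (fun f x) (value y)
    before x y (inj₁ p) = p
    before x y (inj₂ p) = ⊥-elim (not-below x y p)

module _ (A B : LO ℓ) {V : LO ℓ} (f : EndExt (A ⊕ B) V) where

  initialPart : EndExt A V
  initialPart = f ∘ᴱ inlExt {A = A} {B = B}

  -- Lets an extension move on `A ⊕ B` be read as an extension move on `B` alone, with `A` left as
  -- it is.
  residual : EndExt B (complement initialPart)
  residual = record
    { fun = λ y → fun f (inj₂ y) , [ (λ { (x , eq) → inl≢inr (fun-injective f eq) }) ]
    ; embed = λ _ _ p → embed f _ _ (₂∼₂ p)
    ; reflect = λ x y p → drop₂ (reflect f _ _ p)
    ; initial = init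
    }
    where
    inl≢inr : {x : Carrier A} {y : Carrier B} → ¬ _≡_ {A = Carrier A ⊎ Carrier B} (inj₁ x) (inj₂ y)
    inl≢inr ()
    drop₂ : ∀ {x y} → _≤_ (A ⊕ B) (inj₂ x) (inj₂ y) → _≤_ B x y
    drop₂ (₂∼₂ p) = p
    init : ∀ x (y : Carrier (complement initialPart)) → _≤_ V (value y) (fun f (inj₂ x)) →
           ∃ λ z → (fun f (inj₂ z) , _) ≡ y
    init x y p with initial f _ _ p
    ... | inj₁ z , eq = ⊥-elim (complement-∉ initialPart y z eq)
    init x (_ , _) p | inj₂ z , refl = z , refl

-- The game

-- An arbitrary relation rather than a finite list of pairs, so that a position may fix all points
-- of a whole summand.
Position : LO ℓ → LO ℓ → Set (lsuc ℓ)
Position {ℓ} U V = REL (Carrier U) (Carrier V) ℓ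

None : {X Y : Set ℓ} → REL X Y ℓ
None _ _ = ⊥

Adjoin : {X Y : Set ℓ} → REL X Y ℓ → X → Y → REL X Y ℓ
Adjoin R x y x′ y′ = R x′ y′ ⊎ (x′ ≡ x × y′ ≡ y)

data Image {U V U′ V′ : LO ℓ} (f : EndExt U U′) (g : EndExt V V′)
           (R : Position U V) : Position U′ V′ where
  image : ∀ {x y} → R x y → Image f g R (fun f x) (fun g y)

Condition : (ℓ : Level) → Set (lsuc (lsuc ℓ))
Condition ℓ = (U V : LO ℓ) → Position U V → Set (lsuc ℓ)

record Both (E : Condition ℓ) (U V : LO ℓ) (R : Position U V) : Set (lsuc ℓ) where
  constructor both
  field
    forth : E U V R
    back  : E V U (flip R)

open Both

Preserves : Condition ℓ
Preserves {ℓ} U V R =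
  Lift (lsuc ℓ) (∀ {x x′ y y′} → R x y → R x′ y′ → _≤_ U x x′ → _≤_ V y y′)

record Forth (E : Condition ℓ) (U V : LO ℓ) (R : Position U V) : Set (lsuc ℓ) where
  field
    point     : ∀ x → Σ (Carrier V) λ y → E U V (Adjoin R x y)
    extension : ∀ U′ (f : EndExt U U′) → Σ (LO ℓ) λ V′ → Σ (EndExt V V′) λ g → E U′ V′ (Image f g R)

open Forth

-- The second player survives n rounds from the position R ⊆ U × V.
data Equiv {ℓ} : ℕ → Condition ℓ where
  start : {U V : LO ℓ} {R : Position U V} →
          Both Preserves U V R → Equiv zero U V R
  _,_   : {U V : LO ℓ} {R : Position U V} →
          Equiv n U V R → Both (Forth (Equiv n)) U V R → Equiv (suc n) U V R

Equiv-sym : ∀ n {R : Position U V} → Equiv n U V R → Equiv n V U (flip R)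
Equiv-sym zero    (start (both p q)) = start (both q p)
Equiv-sym (suc n) (e , both p q) = Equiv-sym n e , both q p

Equiv-order : ∀ n {R : Position U V} → Equiv n U V R → Both Preserves U V R
Equiv-order zero    (start e) = e
Equiv-order (suc n) (e , _) = Equiv-order n e

mutual
  -- Forgetting related pairs leaves less to preserve, so the same replies still work. This also
  -- serves to reshape positions after a move.
  Equiv-mono : ∀ n {R Q : Position U V} → Q ⇒ R → Equiv n U V R → Equiv n U V Q
  Equiv-mono zero    Q⊆R (start (both (lift p) (lift q))) =
    start (both (lift λ r s → p (Q⊆R r) (Q⊆R s)) (lift λ r s → q (Q⊆R r) (Q⊆R s)))
  Equiv-mono (suc n) Q⊆R (e , both p q) =
    Equiv-mono n Q⊆R e , both (Forth-mono n Q⊆R p) (Forth-mono n (λ r → Q⊆R r) q)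

  Forth-mono : ∀ n {R Q : Position U V} → Q ⇒ R → Forth (Equiv n) U V R → Forth (Equiv n) U V Q
  Forth-mono n Q⊆R p .point x =
    let y , e = point p x
    in y , Equiv-mono n (map-⊎ Q⊆R id) e
  Forth-mono n Q⊆R p .extension U′ f =
    let V′ , g , e = extension p U′ f
    in V′ , g , Equiv-mono n (λ { (image r) → image (Q⊆R r) }) e

-- The second player copies every move.
Equiv-refl : ∀ n (U : LO ℓ) → Equiv n U U _≡_
Equiv-refl zero    U = start (both (lift λ { refl refl p → p }) (lift λ { refl refl p → p }))
Equiv-refl (suc n) U = Equiv-refl n U , both forth-refl (Forth-mono n sym forth-refl)
  where
  forth-refl : Forth (Equiv n) U U _≡_
  forth-refl .point x = x , Equiv-mono n (λ { (inj₁ eq) → eq ; (inj₂ (refl , refl)) → refl }) (Equiv-refl n U)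
  forth-refl .extension U′ f = U′ , f , Equiv-mono n (λ { (image refl) → refl }) (Equiv-refl n U′)

Equiv-≤ : {R : Position U V} → m ≤ⁿ n → Equiv n U V R → Equiv m U V R
Equiv-≤ {n = n} z≤n e = start (Equiv-order n e)
Equiv-≤ (s≤s m≤n) (e , both p q) = Equiv-≤ m≤n e , both (weaken p) (weaken q)
  where
  weaken : {R : Position U V} → Forth (Equiv _) U V R → Forth (Equiv _) U V R
  weaken p .point x = let y , e = point p x in y , Equiv-≤ m≤n e
  weaken p .extension U′ f = let V′ , g , e = extension p U′ f in V′ , g , Equiv-≤ m≤n e

-- Points are carried through `α` and `β`. An extension of `U′` becomes one of `U` by precomposing
-- with `α`, so after an extension move the worlds agree and only the positions are compared.
Equiv-iso : ∀ n {U V U′ V′ : LO ℓ} {R : Position U V} {Q : Position U′ V′}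
            (α : U ≅ U′) (β : V ≅ V′) → (∀ {x y} → Q x y → R (from α x) (from β y)) →
            Equiv n U V R → Equiv n U′ V′ Q
Equiv-iso zero α β Q⊆R (start (both (lift p) (lift q))) = start (both
  (lift λ r s → cancel (≅-sym β) ∘ p (Q⊆R r) (Q⊆R s) ∘ mono (≅-sym α))
  (lift λ r s → cancel (≅-sym α) ∘ q (Q⊆R r) (Q⊆R s) ∘ mono (≅-sym β)))
Equiv-iso (suc n) α β Q⊆R (e , both p q) =
  Equiv-iso n α β Q⊆R e , both (half α β Q⊆R p) (half β α (λ r → Q⊆R r) q)
  where
  half : {U V U′ V′ : LO _} {R : Position U V} {Q : Position U′ V′}
         (α : U ≅ U′) (β : V ≅ V′) → (∀ {x y} → Q x y → R (from α x) (from β y)) →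
         Forth (Equiv n) U V R → Forth (Equiv n) U′ V′ Q
  half α β Q⊆R p .point x =
    let y , e = point p (from α x)
    in to β y , Equiv-iso n α β
         (λ { (inj₁ r) → inj₁ (Q⊆R r) ; (inj₂ (refl , refl)) → inj₂ (refl , from-to β y) }) e
  half {R = R} α β Q⊆R p .extension X f =
    let Y , g , e = extension p X (f ∘ᴱ ext α)
    in Y , g ∘ᴱ ext (≅-sym β) , Equiv-mono n
         (λ { (image {x} r) → subst₂ (Image (f ∘ᴱ ext α) g R) (cong (fun f) (to-from α x)) refl
                                (image (Q⊆R r)) }) e

-- The two strategies are combined. A point is answered in its own summand, an extension by the
-- strategy on the second summand; the game on the other summand gives up one round.
Equiv-⊕ : ExcludedMiddle ℓ → ∀ n {A A′ B B′ : LO ℓ}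
          {R : Position A A′} {Q : Position B B′} →
          Equiv n A A′ R → Equiv n B B′ Q → Equiv n (A ⊕ B) (A′ ⊕ B′) (Pointwise R Q)
Equiv-⊕ em zero (start (both (lift p) (lift p′))) (start (both (lift q) (lift q′))) = start (both
  (lift λ { (inj₁ r) (inj₁ s) (₁∼₁ x) → ₁∼₁ (p r s x)
          ; (inj₁ r) (inj₂ s) _ → ₁∼₂
          ; (inj₂ r) (inj₂ s) (₂∼₂ x) → ₂∼₂ (q r s x) })
  (lift λ { (inj₁ r) (inj₁ s) (₁∼₁ x) → ₁∼₁ (p′ r s x)
          ; (inj₁ r) (inj₂ s) _ → ₁∼₂
          ; (inj₂ r) (inj₂ s) (₂∼₂ x) → ₂∼₂ (q′ r s x) }))
Equiv-⊕ em (suc n) e@(e₀ , _) d@(d₀ , _) = Equiv-⊕ em n e₀ d₀ , both (half e d)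
  (Forth-mono n (λ { (inj₁ r) → inj₁ r ; (inj₂ r) → inj₂ r })
    (half (Equiv-sym (suc n) e) (Equiv-sym (suc n) d)))
  where
  half : {A A′ B B′ : LO _} {R : Position A A′} {Q : Position B B′} →
         Equiv (suc n) A A′ R → Equiv (suc n) B B′ Q →
         Forth (Equiv n) (A ⊕ B) (A′ ⊕ B′) (Pointwise R Q)
  half (e₀ , both p _) (d₀ , both q _) .point (inj₁ x) =
    let y , e = point p x
    in inj₁ y , Equiv-mono n
         (λ { (inj₁ (inj₁ r)) → inj₁ (inj₁ r) ; (inj₁ (inj₂ r)) → inj₂ r
            ; (inj₂ (refl , refl)) → inj₁ (inj₂ (refl , refl)) })
         (Equiv-⊕ em n e d₀)
  half (e₀ , both p _) (d₀ , both q _) .point (inj₂ x) =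
    let y , d = point q x
    in inj₂ y , Equiv-mono n
         (λ { (inj₁ (inj₁ r)) → inj₁ r ; (inj₁ (inj₂ r)) → inj₂ (inj₁ r)
            ; (inj₂ (refl , refl)) → inj₂ (inj₂ (refl , refl)) })
         (Equiv-⊕ em n e₀ d)
  half {A} {A′} {B} {B′} {R} {Q} (e₀ , _) (d₀ , both q _) .extension X f =
    let Y , g , d = extension q _ (residual A B f)
        α = complement-iso (initialPart A B f) em
    in A′ ⊕ Y , ⊕-extʳ {A = A′} g , Equiv-iso n α ≅-refl
         (λ { (image (inj₁ {x} r)) →
                subst₂ (Pointwise R _) (sym (from-to α (inj₁ x))) refl (inj₁ r)
            ; (image (inj₂ {x} r)) →
                subst₂ (Pointwise R _) (sym (from-to α (inj₂ (fun (residual A B f) x)))) refl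
                  (inj₂ (image r)) })
         (Equiv-⊕ em n e₀ d)

-- Formulas of quantifier and modal depth n are decided by the n-round game

module _ {W : LO ℓ} where

  depth : Form W n → ℕ
  depth (_ ≤ᶠ _) = 0
  depth (_ ≐ᶠ _) = 0
  depth ⊥ᶠ       = 0
  depth (φ ⇒ᶠ ψ) = depth φ ⊔ depth ψ
  depth (∀ᶠ φ)   = suc (depth φ)
  depth (□ᶠ φ)   = suc (depth φ)

  constantsT : Term W n → List (Carrier W)
  constantsT (v _)   = []
  constantsT (con c) = c ∷ []

  constants : Form W n → List (Carrier W)
  constants (t ≤ᶠ s) = constantsT t ++ constantsT s
  constants (t ≐ᶠ s) = constantsT t ++ constantsT s
  constants ⊥ᶠ       = []
  constants (φ ⇒ᶠ ψ) = constants φ ++ constants ψ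
  constants (∀ᶠ φ)   = constants φ
  constants (□ᶠ φ)   = constants φ

  evalT-related : (R : Position U V) (t : Term W n) {κ : Carrier W → Carrier U} {κ′ : Carrier W → Carrier V}
                  {ν : Fin n → Carrier U} {ν′ : Fin n → Carrier V} →
                  All (λ c → R (κ c) (κ′ c)) (constantsT t) → (∀ i → R (ν i) (ν′ i)) →
                  R (evalT U t κ ν) (evalT V t κ′ ν′)
  evalT-related R (v i)   _        νs = νs i
  evalT-related R (con c) (r ∷ []) _  = r

  -- For `∀ᶠ` and `□ᶠ` the challenge is made in `V` and answered in `U`, where the hypothesis
  -- applies; implication exchanges the sides by symmetry. Relating just the constants of `φ` leaves
  -- room for positions that cover only finitely many parameters.
  Sat-Equiv : {U V : LO ℓ} {R : Position U V} (φ : Form W n) →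
              depth φ ≤ⁿ m → Equiv m U V R →
              {κ : Carrier W → Carrier U} {κ′ : Carrier W → Carrier V}
              {ν : Fin n → Carrier U} {ν′ : Fin n → Carrier V} →
              All (λ c → R (κ c) (κ′ c)) (constants φ) → (∀ i → R (ν i) (ν′ i)) →
              Sat U κ ν φ → Sat V κ′ ν′ φ
  Sat-Equiv {m = m} {R = R} (t ≤ᶠ s) _ e κs νs (lift p) =
    let κt , κs = ++⁻ (constantsT t) κs
    in lift (lower (forth (Equiv-order m e)) (evalT-related R t κt νs) (evalT-related R s κs νs) p)
  Sat-Equiv {m = m} {U} {V} {R} (t ≐ᶠ s) _ e κs νs (lift p) =
    let κt , κs = ++⁻ (constantsT t) κs
        rt = evalT-related R t κt νs
        rs = evalT-related R s κs νs
        preserve = lower (forth (Equiv-order m e))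
    in lift (Ord.antisym V (preserve rt rs (Ord.reflexive U p)) (preserve rs rt (Ord.reflexive U (sym p))))
  Sat-Equiv ⊥ᶠ _ _ _ _ (lift ())
  Sat-Equiv {m = m} (φ ⇒ᶠ ψ) d e κs νs h p =
    let κφ , κψ = ++⁻ (constants φ) κs
    in Sat-Equiv ψ (m⊔n≤o⇒n≤o (depth φ) _ d) e κψ νs
         (h (Sat-Equiv φ (m⊔n≤o⇒m≤o _ (depth ψ) d) (Equiv-sym m e) κφ νs p))
  Sat-Equiv (∀ᶠ φ) (s≤s d) (_ , both _ q) κs νs h y =
    let x , e = point q y
    in Sat-Equiv φ d (Equiv-sym _ e) (All.map inj₁ κs)
         (λ { fz → inj₂ (refl , refl) ; (fs i) → inj₁ (νs i) }) (h x)
  Sat-Equiv (□ᶠ φ) (s≤s d) (_ , both _ q) κs νs h V′ g =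
    let U′ , f , e = extension q V′ g
    in Sat-Equiv φ d (Equiv-sym _ e) (All.map image κs) (λ i → image (νs i)) (h U′ f)

-- Finitely many n-round types

lower-em : ExcludedMiddle (lsuc ℓ) → ExcludedMiddle ℓ
lower-em em = map′ lower lift em

module _ (em : ExcludedMiddle a) {N : ℕ} where

  bit : Set a → Fin 2
  bit P = if does (em {P}) then fs fz else fz

  bits : (Fin N → Set a) → Fin (2 ^ N)
  bits P = funToFin (bit ∘ P)

  bit-≡ : {P Q : Set a} → bit P ≡ bit Q → P → Q
  bit-≡ {P} {Q} eq p with em {P} | em {Q}
  ... | _     | yes q = q
  ... | no ¬p | no _  = contradiction p ¬p
  bit-≡ () p | yes _ | no _

  bits-≡ : {P Q : Fin N → Set a} → bits P ≡ bits Q → ∀ i → P i → Q i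
  bits-≡ {P} {Q} eq i = bit-≡
    (trans (sym (finToFun-funToFin (bit ∘ P) i))
      (trans (cong (λ c → finToFun c i) eq) (finToFun-funToFin (bit ∘ Q) i)))

Tuple : (Fin k → Carrier U) → (Fin k → Carrier V) → Position U V
Tuple a b x y = ∃ λ i → a i ≡ x × b i ≡ y

-- Equal codes force equivalence, so `size` bounds the number of `n`-round types of orders with `k`
-- marked points.
record Classifier (ℓ : Level) (n k : ℕ) : Set (lsuc ℓ) where
  field
    size  : ℕ
    code  : (U : LO ℓ) → (Fin k → Carrier U) → Fin size
    sound : {U V : LO ℓ} (a : Fin k → Carrier U) (b : Fin k → Carrier V) →
            code U a ≡ code V b → Equiv n U V (Tuple {U = U} {V = V} a b)

open Classifier

module _ (em : ExcludedMiddle (lsuc ℓ)) where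

  private
    em₀ : ExcludedMiddle ℓ
    em₀ = lower-em em

  -- As with Hintikka formulas, a code for `suc n` rounds records the code for `n` rounds, the set
  -- of codes reached by marking one more point, and the set reached by end-extensions. The last set
  -- quantifies over all orders, hence excluded middle one level up. For zero rounds the code is the
  -- order matrix of the marked points.
  classifier : ∀ n k → Classifier ℓ n k
  classifier zero k = record
    { size = (2 ^ k) ^ k
    ; code = λ U a → funToFin (row U a)
    ; sound = λ {U} {V} a b eq → start (both
        (lift λ { (i , refl , refl) (j , refl , refl) → bits-≡ em₀ (rows {U} {V} a b eq i) j })
        (lift λ { (i , refl , refl) (j , refl , refl) → bits-≡ em₀ (sym (rows {U} {V} a b eq i)) j }))
    }
    where
    row : ∀ U → (Fin k → Carrier U) → Fin k → Fin (2 ^ k)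
    row U a i = bits em₀ (λ j → _≤_ U (a i) (a j))
    rows : ∀ {U V} a b → funToFin (row U a) ≡ funToFin (row V b) → ∀ i → row U a i ≡ row V b i
    rows {U} {V} a b eq i = trans (sym (finToFun-funToFin (row U a) i))
      (trans (cong (λ c → finToFun c i) eq) (finToFun-funToFin (row V b) i))
  classifier (suc n) k = record
    { size = size now * (2 ^ size more * 2 ^ size now)
    ; code = λ U a → combine (code now U a) (combine (points U a) (extensions U a))
    ; sound = λ {U} {V} a b eq →
        let eq₁ , eq₂₃ = combine-injective _ _ _ _ eq
            eq₂ , eq₃ = combine-injective _ _ _ _ eq₂₃
        in sound now a b eq₁ , both (half a b eq₂ eq₃)
             (Forth-mono n (λ { (i , p , q) → i , q , p }) (half b a (sym eq₂) (sym eq₃)))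
    }
    where
    now : Classifier ℓ n k
    now = classifier n k
    more : Classifier ℓ n (suc k)
    more = classifier n (suc k)
    PointCode : ∀ U → (Fin k → Carrier U) → Fin (size more) → Set ℓ
    PointCode U a c = Σ (Carrier U) λ x → code more U (extend x a) ≡ c
    points : ∀ U → (Fin k → Carrier U) → Fin (2 ^ size more)
    points U a = bits em₀ (PointCode U a)
    ExtensionCode : ∀ U → (Fin k → Carrier U) → Fin (size now) → Set (lsuc ℓ)
    ExtensionCode U a c = Σ (LO ℓ) λ V → Σ (EndExt U V) λ f → code now V (fun f ∘ a) ≡ c
    extensions : ∀ U → (Fin k → Carrier U) → Fin (2 ^ size now)
    extensions U a = bits em (ExtensionCode U a)
    half : ∀ {U V} a b → points U a ≡ points V b → extensions U a ≡ extensions V b →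
           Forth (Equiv n) U V (Tuple {U = U} {V = V} a b)
    half {U} {V} a b eq₂ eq₃ .point x =
      let y , eq = bits-≡ em₀ {P = PointCode U a} {PointCode V b} eq₂ _ (x , refl)
      in y , Equiv-mono n
           (λ { (inj₁ (i , p , q)) → fs i , p , q ; (inj₂ (refl , refl)) → fz , refl , refl })
           (sound more (extend x a) (extend y b) (sym eq))
    half {U} {V} a b eq₂ eq₃ .extension X f =
      let Y , g , eq = bits-≡ em {P = ExtensionCode U a} {ExtensionCode V b} eq₃ _ (X , f , refl)
      in Y , g , Equiv-mono n (λ { (image (i , refl , refl)) → i , refl , refl })
                   (sound now (fun f ∘ a) (fun g ∘ b) (sym eq))

  code₀ : ∀ n → LO ℓ → ℕ
  code₀ n U = toℕ (code (classifier n 0) U λ ())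

  code₀-sound : ∀ n → code₀ n U ≡ code₀ n V → Equiv n U V None
  code₀-sound n eq =
    Equiv-mono n (λ ()) (sound (classifier n 0) (λ ()) (λ ()) (toℕ-injective eq))

  typical : ℕ × ℕ → LO ℓ
  typical (n , c) with em {Σ (LO ℓ) λ U → code₀ n U ≡ c}
  ... | yes (U , _) = U
  -- A default for numbers that are the code of no order; it merely adds further blocks to the
  -- shuffle.
  ... | no _        = 𝟘

  typical-Equiv : ∀ n U → Equiv n U (typical (n , code₀ n U)) None
  typical-Equiv n U with em {Σ (LO ℓ) λ V → code₀ n V ≡ code₀ n U}
  ... | yes (V , eq) = code₀-sound n (sym eq)
  ... | no ¬∃        = contradiction (U , refl) ¬∃

-- Enumeration of pairs of natural numbers

unpair : ℕ → ℕ × ℕ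
unpair zero    = 0 , 0
unpair (suc k) with unpair k
... | zero  , j = suc j , 0
... | suc i , j = i , suc j

-- `unpair` runs through each antidiagonal from `(d , 0)` to `(0 , d)`; `search` retraces this walk,
-- by induction on `d` and then on `j`.
unpair-surjective : ∀ i j → ∃ λ k → unpair k ≡ (i , j)
unpair-surjective i j = search (i + j) i j refl
  where
  search : ∀ d i j → i + j ≡ d → ∃ λ k → unpair k ≡ (i , j)
  search d i (suc j) eq with search d (suc i) j (trans (sym (+-suc i j)) eq)
  ... | k , p = suc k , next
    where
    next : unpair (suc k) ≡ (i , suc j)
    next rewrite p = refl
  search d zero zero eq = 0 , refl
  -- The predecessor of `(suc i , 0)` is `(0 , i)`, the end of the previous antidiagonal.
  search (suc d) (suc i) zero eq with search d 0 i (trans (sym (+-identityʳ i)) (suc-injective eq))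
  ... | k , p = suc k , next
    where
    next : unpair (suc k) ≡ (suc i , 0)
    next rewrite p = refl

-- Shuffles

module _ (L : ℕ → LO ℓ) where

  -- Left subtrees restart the count at 0 and right subtrees increase it, so that every L k
  -- occurs in every subtree.
  data Tree : ℕ → Set ℓ where
    left  : Tree 0 → Tree n
    mid   : Carrier (L n) → Tree n
    right : Tree (suc n) → Tree n

  infix 4 _⊑_
  data _⊑_ : Rel (Tree n) ℓ where
    l⊑l : ∀ {x y} → x ⊑ y → left {n} x ⊑ left y
    l⊑m : ∀ {x y} → left {n} x ⊑ mid y
    l⊑r : ∀ {x y} → left {n} x ⊑ right y
    m⊑m : ∀ {x y} → _≤_ (L n) x y → mid {n} x ⊑ mid y
    m⊑r : ∀ {x y} → mid {n} x ⊑ right y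
    r⊑r : ∀ {x y} → x ⊑ y → right {n} x ⊑ right y

  ⊑-refl : (x : Tree n) → x ⊑ x
  ⊑-refl (left x)      = l⊑l (⊑-refl x)
  ⊑-refl {n} (mid x)   = m⊑m (Ord.refl (L n))
  ⊑-refl (right x)     = r⊑r (⊑-refl x)

  ⊑-trans : {x y z : Tree n} → x ⊑ y → y ⊑ z → x ⊑ z
  ⊑-trans (l⊑l p) (l⊑l q) = l⊑l (⊑-trans p q)
  ⊑-trans (l⊑l p) l⊑m     = l⊑m
  ⊑-trans (l⊑l p) l⊑r     = l⊑r
  ⊑-trans l⊑m     (m⊑m q) = l⊑m
  ⊑-trans l⊑m     m⊑r     = l⊑r
  ⊑-trans l⊑r     (r⊑r q) = l⊑r
  ⊑-trans {n} (m⊑m p) (m⊑m q) = m⊑m (Ord.trans (L n) p q)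
  ⊑-trans (m⊑m p) m⊑r     = m⊑r
  ⊑-trans m⊑r     (r⊑r q) = m⊑r
  ⊑-trans (r⊑r p) (r⊑r q) = r⊑r (⊑-trans p q)

  ⊑-antisym : {x y : Tree n} → x ⊑ y → y ⊑ x → x ≡ y
  ⊑-antisym (l⊑l p) (l⊑l q)     = cong left (⊑-antisym p q)
  ⊑-antisym {n} (m⊑m p) (m⊑m q) = cong mid (Ord.antisym (L n) p q)
  ⊑-antisym (r⊑r p) (r⊑r q)     = cong right (⊑-antisym p q)

  ⊑-total : (x y : Tree n) → x ⊑ y ⊎ y ⊑ x
  ⊑-total (left x)  (left y)    = map-⊎ l⊑l l⊑l (⊑-total x y)
  ⊑-total (left x)  (mid y)     = inj₁ l⊑m
  ⊑-total (left x)  (right y)   = inj₁ l⊑r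
  ⊑-total (mid x)   (left y)    = inj₂ l⊑m
  ⊑-total {n} (mid x) (mid y)   = map-⊎ m⊑m m⊑m (Ord.total (L n) x y)
  ⊑-total (mid x)   (right y)   = inj₁ m⊑r
  ⊑-total (right x) (left y)    = inj₂ l⊑r
  ⊑-total (right x) (mid y)     = inj₂ m⊑r
  ⊑-total (right x) (right y)   = map-⊎ r⊑r r⊑r (⊑-total x y)

  tree : ℕ → LO ℓ
  tree n = linearOrder (_⊑_ {n}) (⊑-refl _) ⊑-trans ⊑-antisym ⊑-total

  tree-unfold : tree n ≅ tree 0 ⊕ L n ⊕ tree (suc n)
  tree-unfold = record
    { to = λ { (left x) → inj₁ (inj₁ x) ; (mid x) → inj₁ (inj₂ x) ; (right x) → inj₂ x }
    ; from = λ { (inj₁ (inj₁ x)) → left x ; (inj₁ (inj₂ x)) → mid x ; (inj₂ x) → right x }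
    ; to-from = λ { (inj₁ (inj₁ _)) → refl ; (inj₁ (inj₂ _)) → refl ; (inj₂ _) → refl }
    ; mono = λ { (l⊑l p) → ₁∼₁ (₁∼₁ p) ; l⊑m → ₁∼₁ ₁∼₂ ; l⊑r → ₁∼₂
               ; (m⊑m p) → ₁∼₁ (₂∼₂ p) ; m⊑r → ₁∼₂ ; (r⊑r p) → ₂∼₂ p }
    ; cancel = λ { {left _} {left _} (₁∼₁ (₁∼₁ p)) → l⊑l p
                 ; {left _} {mid _} _ → l⊑m
                 ; {left _} {right _} _ → l⊑r
                 ; {mid _} {left _} (₁∼₁ ())
                 ; {mid _} {mid _} (₁∼₁ (₂∼₂ p)) → m⊑m p
                 ; {mid _} {right _} _ → m⊑r
                 ; {right _} {left _} ()
                 ; {right _} {mid _} ()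
                 ; {right _} {right _} (₂∼₂ p) → r⊑r p }
    }

  -- The middle summand of `join` is any order, not just some `L k`; this is what lets a shuffle
  -- swallow the points added by an extension.
  data Shuffle : LO ℓ → Set (lsuc ℓ) where
    whole : ∀ n → Shuffle (tree n)
    join : ∀ {D D₁ M D₂} → Shuffle D₁ → Shuffle D₂ → D ≅ D₁ ⊕ M ⊕ D₂ → Shuffle D

  -- Both sides of the block are again shuffles, so a move inside the block splits the game into
  -- three games that can be played separately.
  record Slot (D : LO ℓ) : Set (lsuc ℓ) where
    field
      before block after : LO ℓ
      before-shuffle : Shuffle before
      after-shuffle  : Shuffle after
      iso            : D ≅ before ⊕ block ⊕ after

    inject : Carrier block → Carrier D
    inject x = from iso (inj₁ (inj₂ x))

  open Slot

  -- What follows the slot in `D₁` joins with `D₂` across `M` into one shuffle; associativity does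
  -- the rest. `slotʳ` is the mirror image.
  slotˡ : ∀ {D D₁ M D₂} → Shuffle D₂ → D ≅ D₁ ⊕ M ⊕ D₂ → Slot D₁ → Slot D
  slotˡ {M = M} {D₂} d₂ α σ = record
    { before = before σ
    ; block = block σ
    ; after = after σ ⊕ M ⊕ D₂
    ; before-shuffle = before-shuffle σ
    ; after-shuffle  = join {M = M} (after-shuffle σ) d₂ ≅-refl
    ; iso = ≅-trans α (≅-trans
        (⊕-cong (≅-trans (⊕-cong (iso σ) ≅-refl) (⊕-assoc (before σ ⊕ block σ) (after σ) M)) ≅-refl)
        (⊕-assoc (before σ ⊕ block σ) (after σ ⊕ M) D₂))
    }

  slotʳ : ∀ {D D₁ M D₂} → Shuffle D₁ → D ≅ D₁ ⊕ M ⊕ D₂ → Slot D₂ → Slot D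
  slotʳ {D₁ = D₁} {M} d₁ α σ = record
    { before = D₁ ⊕ M ⊕ before σ
    ; block = block σ
    ; after = after σ
    ; before-shuffle = join {M = M} d₁ (before-shuffle σ) ≅-refl
    ; after-shuffle  = after-shuffle σ
    ; iso = ≅-trans α (≅-trans (⊕-cong ≅-refl (iso σ)) (≅-trans
        (≅-sym (⊕-assoc (D₁ ⊕ M) (before σ ⊕ block σ) (after σ)))
        (⊕-cong (≅-sym (⊕-assoc (D₁ ⊕ M) (before σ) (block σ))) ≅-refl)))
    }

  Locates : ∀ {D} → Carrier D → Slot D → Set ℓ
  Locates x σ = ∃ λ z → inject σ z ≡ x

  locate-tree : (x : Tree n) → Σ (Slot (tree n)) (Locates x)
  locate-tree (left x) =
    let σ , z , eq = locate-tree x in slotˡ (whole _) tree-unfold σ , z , cong left eq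
  locate-tree (mid x) =
    record { before-shuffle = whole _ ; after-shuffle = whole _ ; iso = tree-unfold } , x , refl
  locate-tree (right x) =
    let σ , z , eq = locate-tree x in slotʳ (whole _) tree-unfold σ , z , cong right eq

  locate : ∀ {D} → Shuffle D → (x : Carrier D) → Σ (Slot D) (Locates x)
  locate (whole n) x = locate-tree x
  locate {D} (join d₁ d₂ α) x = go (to α x) (from-to α x)
    where
    go : ∀ p → from α p ≡ x → Σ (Slot D) (Locates x)
    go (inj₁ (inj₁ y)) eq =
      let σ , z , eq′ = locate d₁ y in slotˡ d₂ α σ , z , trans (cong (λ w → from α (inj₁ (inj₁ w))) eq′) eq
    go (inj₁ (inj₂ y)) eq =
      record { before-shuffle = d₁ ; after-shuffle = d₂ ; iso = α } , y , eq
    go (inj₂ y) eq =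
      let σ , z , eq′ = locate d₂ y in slotʳ d₁ α σ , z , trans (cong (from α ∘ inj₂) eq′) eq

  -- Each step to the right raises the count by one, so `k` steps lead from `n` to `k + n`.
  block-tree : ∀ k → Σ (Slot (tree n)) λ σ → block σ ≡ L (k + n)
  block-tree zero =
    record { before-shuffle = whole _ ; after-shuffle = whole _ ; iso = tree-unfold } , refl
  block-tree {n} (suc k) =
    let σ , eq = block-tree {suc n} k
    in slotʳ (whole _) tree-unfold σ , trans eq (cong L (+-suc k n))

  block-occurs : ∀ {D} → Shuffle D → ∀ k → Σ (Slot D) λ σ → block σ ≡ L k
  block-occurs (whole n) k =
    -- The right spine of `tree n` starts at index `n`, so the search enters the left subtree, where
    -- the count restarts at 0.
    let σ , eq = block-tree {0} k
    in slotˡ (whole _) tree-unfold σ , trans eq (cong L (+-identityʳ k))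
  block-occurs (join d₁ d₂ α) k =
    let σ , eq = block-occurs d₁ k in slotˡ d₂ α σ , eq

  module _ (em : ExcludedMiddle ℓ) (dense : ∀ n M → ∃ λ k → Equiv n M (L k) None) where

    -- A point is answered in an equivalent block of the other shuffle, and the parts on either side
    -- are shuffles, to which induction on `n` applies.
    Shuffle-Equiv : ∀ n {D E} → Shuffle D → Shuffle E → Equiv n D E None
    Shuffle-Equiv zero d e = start (both (lift λ ()) (lift λ ()))
    Shuffle-Equiv (suc n) d e =
      Shuffle-Equiv n d e , both (half d e) (Forth-mono n (λ ()) (half e d))
      where
      -- Equivalence for `suc n` rounds is required because one round is spent on the point inside
      -- the block.
      match : ∀ {E} → Shuffle E → ∀ M → Σ (Slot E) λ τ → Equiv (suc n) M (block τ) None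
      match e M with dense (suc n) M
      ... | k , eq with block-occurs e k
      ... | τ , refl = τ , eq
      half : ∀ {D E} → Shuffle D → Shuffle E → Forth (Equiv n) D E None
      half d e .point x with locate d x
      ... | σ , z , refl with match e (block σ)
      ... | τ , (_ , both p _) with point p z
      ... | w , eq = inject τ w , Equiv-iso n (≅-sym (iso σ)) (≅-sym (iso τ))
        (λ { (inj₂ (refl , refl)) → subst₂ (Pointwise _ _)
               (sym (to-from (iso σ) _)) (sym (to-from (iso τ) _)) (inj₁ (inj₂ (inj₂ (refl , refl)))) })
        (Equiv-⊕ em n
          (Equiv-⊕ em n (Shuffle-Equiv n (before-shuffle σ) (before-shuffle τ)) eq)
          (Shuffle-Equiv n (after-shuffle σ) (after-shuffle τ)))
      -- The reply puts on top of `E` the same points that `X` adds to `D`.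
      half {E = E} d e .extension X f = E ⊕ complement f , inlExt ,
        Equiv-iso n (complement-iso f em) ≅-refl (λ { (image ()) })
          (Equiv-⊕ em n (Shuffle-Equiv n d e) (Equiv-refl n _))

-- Absorbing extensions

module _ (em : ExcludedMiddle (lsuc ℓ)) where

  private
    em₀ : ExcludedMiddle ℓ
    em₀ = lower-em em

  -- Representatives for all numbers of rounds are listed together, so that a single shuffle serves
  -- sentences of every depth.
  blocks : ℕ → LO ℓ
  blocks k = typical em (unpair k)

  blocks-dense : ∀ n M → ∃ λ k → Equiv n M (blocks k) None
  blocks-dense n M =
    let k , eq = unpair-surjective n (code₀ em n M)
    in k , transport (λ p → Equiv n M (typical em p) None) (sym eq) (typical-Equiv em n M)

  module Closure (W : LO ℓ) where

    S W⁺ : LO ℓ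
    S  = tree blocks 0
    W⁺ = W ⊕ S

    record Cut (cs : List (Carrier W⁺)) : Set (lsuc ℓ) where
      field
        lowerPart upperPart : LO ℓ
        upper-shuffle : Shuffle blocks upperPart
        iso : W⁺ ≅ lowerPart ⊕ upperPart
        below : All (λ c → ∃ λ x → to iso c ≡ inj₁ x) cs

    -- The constants are treated one by one. If one lies in the upper part, the cut moves up to just
    -- after the block containing it; what remains above is still a shuffle, and earlier constants
    -- stay below.
    cut : ∀ cs → Cut cs
    cut [] = record { upper-shuffle = whole 0 ; iso = ≅-refl ; below = [] }
    cut (c ∷ cs) = place (to iso c) refl
      where
      open Cut (cut cs)
      place : ∀ p → to iso c ≡ p → Cut (c ∷ cs)
      place (inj₁ x) eq = record { upper-shuffle = upper-shuffle ; iso = iso ; below = (x , eq) ∷ below }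
      place (inj₂ y) eq with locate blocks upper-shuffle y
      ... | σ , z , refl = record
        { lowerPart = lowerPart ⊕ (before ⊕ block)
        ; upperPart = after
        ; upper-shuffle = after-shuffle
        ; iso = ≅-trans iso α
        ; below = (inj₂ (inj₂ z) , trans (cong (to α) eq) (to-from α (inj₁ (inj₂ (inj₂ z)))))
                  ∷ All.map (λ { (x , eq) → inj₁ x , cong (to α) eq }) below
        }
        where
        open Slot σ renaming (iso to slot-iso)
        α : lowerPart ⊕ upperPart ≅ lowerPart ⊕ (before ⊕ block) ⊕ after
        α = ≅-trans (⊕-cong ≅-refl slot-iso) (≅-sym (⊕-assoc lowerPart (before ⊕ block) after))

    -- After cutting above `cs`, the order `V ⊕ S` is `lowerPart` followed by `upperPart ⊕ M ⊕ S`.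
    -- The latter is a shuffle by `join`, hence equivalent to `upperPart`.
    absorb : ∀ n cs (f : EndExt W⁺ V) →
             Σ (LO ℓ) λ X → Σ (EndExt V X) λ g → Σ (Position X W⁺) λ R →
               Equiv n X W⁺ R × All (λ c → R (fun g (fun f c)) c) cs
    absorb {V = V} n cs f = V ⊕ S , inlExt , R , Equiv-iso n (≅-sym β) (≅-sym iso) id
        (Equiv-⊕ em₀ n (Equiv-refl n lowerPart)
          (Shuffle-Equiv blocks em₀ blocks-dense n (join upper-shuffle (whole 0) ≅-refl) upper-shuffle))
      , All.map (λ { {c} (x , eq) → related x eq }) below
      where
      open Cut (cut cs)
      M = complement f
      γ : V ≅ W⁺ ⊕ M
      γ = ≅-sym (complement-iso f em₀)
      δ : W⁺ ⊕ M ⊕ S ≅ lowerPart ⊕ (upperPart ⊕ M ⊕ S)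
      δ = ≅-trans (⊕-cong (≅-trans (⊕-cong iso ≅-refl) (⊕-assoc lowerPart upperPart M)) ≅-refl)
                  (⊕-assoc lowerPart (upperPart ⊕ M) S)
      β : V ⊕ S ≅ lowerPart ⊕ (upperPart ⊕ M ⊕ S)
      β = ≅-trans (⊕-cong γ ≅-refl) δ
      R : Position (V ⊕ S) W⁺
      -- The identity on `lowerPart`, with no pairs above the cut.
      R x y = Pointwise _≡_ None (to β x) (to iso y)
      related : ∀ {c} x → to iso c ≡ inj₁ x → R (inj₁ (fun f c)) c
      related {c} x eq = subst₂ (Pointwise _≡_ None)
        (sym (trans (cong (λ p → to δ (inj₁ p)) (from-to (complement-iso f em₀) (inj₁ c)))
                    (to-δ eq)))
        (sym eq) (inj₁ refl)
        where
        to-δ : ∀ {c x} → to iso c ≡ inj₁ x → to δ (inj₁ (inj₁ c)) ≡ inj₁ x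
        to-δ eq rewrite eq = refl

    -- Necessity passes from `V` up to the absorbing extension `X`, from there by the game down to
    -- `W⁺`, and so to every extension `U` of `W⁺`.
    possibly-necessary⇒necessary :
      (φ : Sentence W⁺) (f : EndExt W⁺ V) (ν : Fin 0 → Carrier V) → Sat V (fun f) ν (□ᶠ φ) →
      (g : EndExt W⁺ U) (ν′ : Fin 0 → Carrier U) → Sat U (fun g) ν′ φ
    possibly-necessary⇒necessary {U = U} φ f ν h g ν′
      with absorb (suc (depth φ)) (constants φ) f
    ... | X , k , R , e , cs =
      -- This outer use only replaces one empty assignment by another, as functions on `Fin 0` need
      -- not be definitionally equal.
      Sat-Equiv φ ≤-refl (Equiv-refl _ U) (All.universal (λ _ → refl) _) (λ ())
        (Sat-Equiv (□ᶠ φ) ≤-refl e {ν = fun k ∘ ν} {ν′ = λ ()} cs (λ ())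
          (λ Y l → h Y (l ∘ᴱ k)) U g)

    -- Soundness of `S5`

    module _ (σ : ℕ → Sentence W⁺) where

      -- Makes Boolean tautologies applicable to satisfaction: excluded middle supplies truth values
      -- for variables and for boxed formulas, which `evalB` treats as atoms.
      Sat-reflects : ∀ V κ (ν : Fin 0 → Carrier V) →
        ∀ φ → Reflects (Sat V κ ν (subst σ φ))
                (evalB (λ i → does (em {Sat V κ ν (σ i)}))
                       (λ χ → does (em {Sat V κ ν (□ᶠ (subst σ χ))})) φ)
      Sat-reflects V κ ν (var i)  = proof em
      Sat-reflects V κ ν ⊥ᵐ       = ofⁿ λ ()
      Sat-reflects V κ ν (φ ⇒ᵐ ψ) = Sat-reflects V κ ν φ →-reflects Sat-reflects V κ ν ψ
      Sat-reflects V κ ν (□ᵐ φ)   = proof em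

      -- Soundness has to be proved at all extensions of W⁺ at once because of necessitation.
      S5-sound : ∀ {ψ} → S5 ψ → (f : EndExt W⁺ V) (ν : Fin 0 → Carrier V) →
                 Sat V (fun f) ν (subst σ ψ)
      S5-sound {V = V} (taut {φ} t) f ν = invert-true (t _ _) (Sat-reflects V (fun f) ν φ)
        where
        invert-true : ∀ {p} {P : Set p} {b} → b ≡ true → Reflects P b → P
        invert-true refl (ofʸ p) = p
      S5-sound axK f ν p q V g = p V g (q V g)
      S5-sound {V = V} axT f ν p = p V idExt
      S5-sound ax4 f ν p V g X h = p X (h ∘ᴱ g)
      -- A witness `X` of possibility extends `W⁺` through `V`, so the formula is necessary at `W⁺`
      -- and thus true at `V`, itself an extension of `W⁺` by `f`.
      S5-sound (axB {φ}) f ν p = decidable-stable em λ ¬q → lower (p λ X g h → lift (¬q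
        (possibly-necessary⇒necessary (subst σ φ) (g ∘ᴱ f) (fun g ∘ ν) h f ν)))
      S5-sound (mp p q) f ν = S5-sound p f ν (S5-sound q f ν)
      S5-sound (nec p) f ν V g = S5-sound p (g ∘ᴱ f) (fun g ∘ ν)

theorem9p7 : ∀ {ℓ : Level} → ExcludedMiddle (lsuc ℓ) →
    (W : LO ℓ) → Σ (LO ℓ) (λ W′ → EndExt W W′ ×
    (∀ ψ → S5 ψ → Val W′ (AllSentences W′) ψ))
theorem9p7 em W = W⁺ , inlExt , λ ψ p σ _ → S5-sound σ p idExt (λ ())
  where open Closure em W
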